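{- For every equation system $\Xi$ and every pair of finite trees $t_1, t_2 \in T$, the computation of $\mathit{unify}_\Xi(t_1,t_2)$ terminates, i.e. it makes only finitely many recursive calls and ends either with an equation system or with failure $\bot$.
   Context: **Trees.** $\mathbb{V}$ (variables) and $\mathbb{C}$ (constructors) are countably infinite sets, with an arity function $\mathbb{C}\to\mathbb{N}$ (arity $0$ allowed); $f^n$ denotes a constructor $f$ of arity $n$. The set $T$ of finite trees is the least set containing $\mathbb{V}$ and all $f^n(t_1,\dots,t_n)$ with $t_i\in T$. A head tree is a tree $f^n(x_1,\dots,x_n)$ with all $x_i\in\mathbb{V}$; $T^H$ is the set of head trees. **Equation systems.** An equation is written $[X\equiv y,\,t]$, where $X$ is a non-empty finite set of variables, $y\in X$ is the representing variable, and $t$ is either a head tree or $\bot$ (missing). An equation system $\Xi$ is a finite set of equations with pairwise disjoint left-hand sides $X$. $dom(\Xi)$ is the union of its left-hand sides. $\Xi,(X\equiv x,t)$ denotes the system obtained by removing from $\Xi$ all equations whose left-hand side intersects $X$ and then adding $[X\equiv x,t]$. **Operations.** - $\mathit{find}_\Xi(x)=(x,\bot)$ if $x\notin dom(\Xi)$; $\mathit{find}_\Xi(x)=(x',t)$ if $[X\equiv x',t]\in\Xi$ and $x\in X$. - $bind_\Xi(x,t)=\Xi,(\{x\}\equiv x,t)$ if $x\notin dom(\Xi)$; $bind_\Xi(x,t)=\Xi,(X\equiv x',t)$ if $[X\equiv x',t']\in\Xi$ and $x\in X$ (here $t\in T^H$). - $union_\Xi(x,y)$ returns an equation system together with either $\bot$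 or a pair of head trees: (i) $union_\Xi(x,x)=\Xi,\bot$; (ii) if $x\ne y$ and $x,y\notin dom(\Xi)$: $[\Xi,(\{x,y\}\equiv x,\bot)],\bot$; (iii) if $[X\equiv x',t]\in\Xi$, $x\in X$, $y\notin dom(\Xi)$: $[\Xi,(X\cup\{y\}\equiv x',t)],\bot$; (iv) if $x\notin dom(\Xi)$ and $y\in dom(\Xi)$: $union_\Xi(y,x)$; (v) if $x,y$ belong to the left-hand side of the same equation: $\Xi,\bot$; (vi) if $[X\equiv x',t_1],[Y\equiv y',t_2]\in\Xi$ are distinct equations, $x\in X$, $y\in Y$: if $t_1,t_2$ are both head trees, the result is $[\Xi,(X\cup Y\equiv x',t_1)],(t_1,t_2)$; otherwise it is $[\Xi,(X\cup Y\equiv x',t)],\bot$, where $t$ is the one of $t_1,t_2$ that is a head tree if there is one, and $t=\bot$ otherwise. **Unification algorithm.** $\mathit{unify}_\Xi(t,s)$, for $t,s\in T$, returns an equation system or $\bot$ (failure), according to the following rules; failure of any recursive call makes the whole computation fail. - For variables $x,y$: if $union_\Xi(x,y)=\Xi',\bot$, the result is $\Xi'$; if $union_\Xi(x,y)=\Xi',(t_1,t_2)$, the result is $\mathit{unify}_{\Xi'}(t_1,t_2)$. - For a variable $x$ and a non-variable tree $t=f^n(t_1,\dots,t_n)$: if $\mathit{find}_\Xi(x)=(x',t')$ with $t'\neq\bot$, the result is $\mathit{unify}_\Xi(t',t)$. If $\mathit{find}_\Xi(x)=(x',\bot)$, choose fresh distinct variables $y_1,\dots,y_n$ (distinct from all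 variables occurring in the inputs, in $\Xi$, and from all variables generated so far), set $\Xi_0=bind_\Xi(x',f^n(y_1,\dots,y_n))$ and $\Xi_i=\mathit{unify}_{\Xi_{i-1}}(y_i,t_i)$ for $i=1,\dots,n$; the result is $\Xi_n$. - For a non-variable tree $t$ and a variable $x$: $\mathit{unify}_\Xi(t,x)$ is computed by the preceding rules as $\mathit{unify}_\Xi(x,t)$. - $\mathit{unify}_{\Xi_0}(f^n(t_1,\dots,t_n),f^n(t'_1,\dots,t'_n))=\Xi_n$ where $\Xi_i=\mathit{unify}_{\Xi_{i-1}}(t_i,t'_i)$ for $i=1,\dots,n$. - $\mathit{unify}_\Xi(f^n(\dots),g^m(\dots))=\bot$ if $f^n\neq g^m$. -}

module Defs where

open import Data.List.Base using (List; []; _∷_; [_]; _++_; concatMap; filter)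
open import Data.List.Membership.Propositional using (_∈_; _∉_)
open import Data.List.Membership.Propositional.Properties using (∈-++⁺ˡ)
import Data.List.Relation.Binary.Disjoint.DecPropositional as DecDisjoint
open import Data.List.Relation.Binary.Disjoint.Propositional using (Disjoint)
open import Data.List.Relation.Unary.All as All using (All)
open import Data.List.Relation.Unary.All.Properties using (all-filter)
open import Data.List.Relation.Unary.AllPairs using (AllPairs; _∷_)
open import Data.List.Relation.Unary.AllPairs.Properties using (filter⁺)
open import Data.List.Relation.Unary.Any using (here)
open import Data.List.Relation.Unary.Unique.Propositional using (Unique)
open import Data.Maybe.Base using (Maybe; just; nothing; maybe; _<∣>_)
open import Data.Nat.Base using (ℕ)
import Data.Nat.Properties as ℕ
open import Data.Product.Base using (_×_; _,_; ∃-syntax)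
open import Data.Sum.Base using (_⊎_)
open import Data.Vec.Base as Vec using (Vec; []; _∷_; toList)
open import Function.Base using (flip)
open import Function.Bundles using (_↔_)
open import Function.Properties.Inverse using (↔⇒↣)
open import Induction.WellFounded using (Acc)
open import Relation.Binary.Construct.Closure.ReflexiveTransitive using (Star)
open import Relation.Binary.Definitions using (DecidableEquality; Decidable)
open import Relation.Binary.PropositionalEquality using (_≡_; _≢_; refl)
open import Relation.Nullary.Decidable using (via-injection)

record Signature : Set₁ where
  field
    Var   : Set
    Con   : Set
    var↔ℕ : Var ↔ ℕ
    con↔ℕ : Con ↔ ℕ
    arity : Con → ℕ

module Unification (S : Signature) where
  open Signature S public

  _≟ᵛ_ : DecidableEquality Var
  _≟ᵛ_ = via-injection (↔⇒↣ var↔ℕ) ℕ._≟_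

  data Tree : Set where
    var : Var → Tree
    con : (f : Con) → Vec Tree (arity f) → Tree

  record HeadTree : Set where
    constructor head
    field
      root : Con
      args : Vec Var (arity root)

  ⌜_⌝ : HeadTree → Tree
  ⌜ head f xs ⌝ = con f (Vec.map var xs)

  mutual
    treeVars : Tree → List Var
    treeVars (var x)    = [ x ]
    treeVars (con f ts) = treesVars ts

    treesVars : ∀ {n} → Vec Tree n → List Var
    treesVars []       = []
    treesVars (t ∷ ts) = treeVars t ++ treesVars ts

  -- Finite sets of variables are given by lists; only membership in the list
  -- is ever used.  Union of sets is _++_.
  record Equation : Set where
    constructor equation
    field
      lhs     : List Var
      rep     : Var
      rep∈lhs : rep ∈ lhs
      rhs     : Maybe HeadTree
  open Equation public

  -- Left-hand sides are non-empty, so pairwise disjointness of the entries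
  -- also makes the list of equations duplicate-free.
  record System : Set where
    constructor system
    field
      equations : List Equation
      disjoint  : AllPairs (λ E F → Disjoint (lhs E) (lhs F)) equations
  open System public

  dom : System → List Var
  dom Ξ = concatMap lhs (equations Ξ)

  equationVars : Equation → List Var
  equationVars E = lhs E ++ maybe (λ h → treeVars ⌜ h ⌝) [] (rhs E)

  systemVars : System → List Var
  systemVars Ξ = concatMap equationVars (equations Ξ)

  disjointFrom? : Decidable (λ E F → Disjoint (lhs E) (lhs F))
  disjointFrom? E F = DecDisjoint.disjoint? _≟ᵛ_ (lhs E) (lhs F)

  -- Ξ ▷ [X ≡ x , t] is the system written Ξ,(X ≡ x , t).
  infixl 5 _▷_
  _▷_ : System → Equation → System
  system Es d ▷ E = system (E ∷ filter (disjointFrom? E) Es)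
    (all-filter (disjointFrom? E) Es ∷ filter⁺ (disjointFrom? E) d)

  data Find (Ξ : System) (x : Var) : Var → Maybe HeadTree → Set where
    absent  : x ∉ dom Ξ → Find Ξ x x nothing
    present : ∀ {E} → E ∈ equations Ξ → x ∈ lhs E → Find Ξ x (rep E) (rhs E)

  data Bind (Ξ : System) (x : Var) (h : HeadTree) : System → Set where
    absent  : x ∉ dom Ξ →
              Bind Ξ x h (Ξ ▷ equation [ x ] x (here refl) (just h))
    present : ∀ {E} → E ∈ equations Ξ → x ∈ lhs E →
              Bind Ξ x h (Ξ ▷ equation (lhs E) (rep E) (rep∈lhs E) (just h))

  data Union (Ξ : System) : Var → Var → System → Maybe (HeadTree × HeadTree) → Set where
    same-var : ∀ {x} → Union Ξ x x Ξ nothing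
    both-absent : ∀ {x y} → x ≢ y → x ∉ dom Ξ → y ∉ dom Ξ →
      Union Ξ x y (Ξ ▷ equation (x ∷ y ∷ []) x (here refl) nothing) nothing
    right-absent : ∀ {x y E} → E ∈ equations Ξ → x ∈ lhs E → y ∉ dom Ξ →
      Union Ξ x y (Ξ ▷ equation (lhs E ++ [ y ]) (rep E) (∈-++⁺ˡ (rep∈lhs E)) (rhs E)) nothing
    left-absent : ∀ {x y Ξ′ r} → x ∉ dom Ξ → y ∈ dom Ξ →
      Union Ξ y x Ξ′ r → Union Ξ x y Ξ′ r
    same-equation : ∀ {x y E} → E ∈ equations Ξ → x ∈ lhs E → y ∈ lhs E →
      Union Ξ x y Ξ nothing
    merge-heads : ∀ {x y E F h₁ h₂} → E ∈ equations Ξ → F ∈ equations Ξ → E ≢ F →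
      x ∈ lhs E → y ∈ lhs F → rhs E ≡ just h₁ → rhs F ≡ just h₂ →
      Union Ξ x y (Ξ ▷ equation (lhs E ++ lhs F) (rep E) (∈-++⁺ˡ (rep∈lhs E)) (just h₁))
        (just (h₁ , h₂))
    merge : ∀ {x y E F} → E ∈ equations Ξ → F ∈ equations Ξ → E ≢ F →
      x ∈ lhs E → y ∈ lhs F → rhs E ≡ nothing ⊎ rhs F ≡ nothing →
      Union Ξ x y (Ξ ▷ equation (lhs E ++ lhs F) (rep E) (∈-++⁺ˡ (rep∈lhs E)) (rhs E <∣> rhs F))
        nothing

  -- States of the recursive evaluation: `unify Ξ t s` is a call about to be
  -- made, `done Ξ` and `failed` are the outcomes, and
  -- `c then (t₁ , s₁) ∷ … ∷ (tₙ , sₙ) ∷ []` evaluates c and, if it yields Ξ₀,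
  -- computes Ξᵢ = unify_{Ξᵢ₋₁}(tᵢ , sᵢ) for i = 1, …, n, with result Ξₙ.
  infixl 4 _then_
  data Computation : Set where
    unify  : System → Tree → Tree → Computation
    done   : System → Computation
    failed : Computation
    _then_ : Computation → List (Tree × Tree) → Computation

  -- The list records the variables of the original inputs together with all
  -- variables generated so far.
  infix 3 _∣_
  data Config : Set where
    _∣_ : List Var → Computation → Config

  infix 2 _⟶_
  data _⟶_ : Config → Config → Set where
    var-var : ∀ {G Ξ Ξ′ x y} → Union Ξ x y Ξ′ nothing →
      G ∣ unify Ξ (var x) (var y) ⟶ G ∣ done Ξ′
    var-var-heads : ∀ {G Ξ Ξ′ x y h₁ h₂} → Union Ξ x y Ξ′ (just (h₁ , h₂)) →
      G ∣ unify Ξ (var x) (var y) ⟶ G ∣ unify Ξ′ ⌜ h₁ ⌝ ⌜ h₂ ⌝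

    var-con-bound : ∀ {G Ξ x x′ h f ts} → Find Ξ x x′ (just h) →
      G ∣ unify Ξ (var x) (con f ts) ⟶ G ∣ unify Ξ ⌜ h ⌝ (con f ts)
    var-con-free : ∀ {G Ξ Ξ₀ x x′ f ts} → Find Ξ x x′ nothing →
      (ys : Vec Var (arity f)) → Unique (toList ys) →
      All (_∉ (x ∷ treesVars ts ++ systemVars Ξ ++ G)) (toList ys) →
      Bind Ξ x′ (head f ys) Ξ₀ →
      G ∣ unify Ξ (var x) (con f ts) ⟶
      toList ys ++ G ∣ done Ξ₀ then toList (Vec.zip (Vec.map var ys) ts)

    con-var : ∀ {G Ξ x f ts} →
      G ∣ unify Ξ (con f ts) (var x) ⟶ G ∣ unify Ξ (var x) (con f ts)

    con-con : ∀ {G Ξ f ts ss} →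
      G ∣ unify Ξ (con f ts) (con f ss) ⟶ G ∣ done Ξ then toList (Vec.zip ts ss)
    con-clash : ∀ {G Ξ f g ts ss} → f ≢ g →
      G ∣ unify Ξ (con f ts) (con g ss) ⟶ G ∣ failed

    then-step : ∀ {G G′ c c′ ps} → G ∣ c ⟶ G′ ∣ c′ →
      G ∣ c then ps ⟶ G′ ∣ c′ then ps
    then-next : ∀ {G Ξ t s ps} →
      G ∣ done Ξ then (t , s) ∷ ps ⟶ G ∣ unify Ξ t s then ps
    then-done : ∀ {G Ξ} →
      G ∣ done Ξ then [] ⟶ G ∣ done Ξ
    then-failed : ∀ {G ps} →
      G ∣ failed then ps ⟶ G ∣ failed

  data Final : Config → Set where
    done   : ∀ {G Ξ} → Final (G ∣ done Ξ)
    failed : ∀ {G} → Final (G ∣ failed)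

  infix 2 _⟶*_
  _⟶*_ : Config → Config → Set
  _⟶*_ = Star _⟶_

  -- Every run is finite, whatever fresh variables are chosen, and a run can
  -- stop only at an equation system or at failure.
  Terminates : Config → Set
  Terminates c = Acc (flip _⟶_) c ×
                 (∀ {d} → c ⟶* d → Final d ⊎ (∃[ e ] (d ⟶ e)))

  start : System → Tree → Tree → Config
  start Ξ t s = treeVars t ++ treeVars s ++ systemVars Ξ ∣ unify Ξ t s

{-# OPTIONS --safe #-}
-- Let N be the number of equations of Ξ that carry a head tree, and let C be
-- the number of constructor occurrences in the pending pairs of trees that are
-- not paired with another constructor when the two trees are laid over each
-- other.  Merging two bound classes lowers N by one and leaves C alone, because
-- two head trees overlap completely; binding a variable raises N by one and
-- lowers C by one; replacing a bound variable by its head tree lowers C.  So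
-- N + 2C never grows, and it drops in all of these steps; every other step
-- shrinks the plain size of the pending work.
module Submission where

open import Data.List.Base using (List; []; _∷_; _++_; filter; map)
import Data.List.Extrema.Nat as Extrema
import Data.List.Membership.DecPropositional as DecMembership
open import Data.List.Membership.Propositional using (_∈_; _∉_; find)
open import Data.List.Membership.Propositional.Properties using (∈-map⁺; ∈-++⁺ˡ; ∈-++⁺ʳ; ∈-concatMap⁻)
open import Data.List.Relation.Unary.All as All using (All; []; _∷_)
open import Data.List.Relation.Unary.AllPairs using ([]; _∷_)
open import Data.List.Relation.Unary.Any using (here; there)
open import Data.List.Relation.Unary.Unique.Propositional using (Unique)
open import Data.Maybe.Base using (Maybe; just; nothing; maybe; _<∣>_)
open import Data.Nat.Base using (ℕ; suc; _+_; _*_; _≤_; _<_; z≤n; s≤s)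
open import Data.Nat.Induction using (<-wellFounded)
open import Data.Nat.ListAction using (sum)
open import Data.Nat.Properties
open import Data.Nat.Tactic.RingSolver using (solve-∀)
open import Data.Product.Base using (_×_; _,_; ∃-syntax)
open import Data.Product.Relation.Binary.Lex.Strict using (×-Lex; ×-wellFounded)
open import Data.Sum.Base using (_⊎_; inj₁; inj₂)
open import Data.Vec.Base as Vec using (Vec; []; _∷_; toList)
open import Function.Base using (_∘_; flip; const)
open import Function.Bundles using (Inverse)
open import Function.Properties.Inverse using (↔⇒↣)
open import Induction.WellFounded using (WellFounded; module Subrelation)
open import Level using (0ℓ)
import Relation.Binary.Construct.On as On
open import Relation.Binary.Definitions using (DecidableEquality)
open import Relation.Binary.PropositionalEquality using (_≡_; _≢_; refl; sym; cong; subst₂)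
open import Relation.Nullary using (¬_; yes; no; contradiction)
open import Relation.Nullary.Decidable using (via-injection)
open import Relation.Unary using (Pred; Decidable)

open import Defs

-- Weight sums over filtered lists.

+-exchange : ∀ a b c → a + (b + c) ≡ b + (a + c)
+-exchange = solve-∀

module _ {A : Set} {P : Pred A 0ℓ} (P? : Decidable P) (w : A → ℕ) where

  sum-filter-≤ : ∀ xs → sum (map w (filter P? xs)) ≤ sum (map w xs)
  sum-filter-≤ []       = z≤n
  sum-filter-≤ (x ∷ xs) with P? x
  ... | yes _ = +-monoʳ-≤ (w x) (sum-filter-≤ xs)
  ... | no  _ = m≤n⇒m≤o+n (w x) (sum-filter-≤ xs)

  -- Meant for the filter inside `_▷_`: an equation that meets the new left-hand side is thrown out,
  -- so its weight can pay for the new one.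
  sum-filter-∈ : ∀ {a xs} → a ∈ xs → ¬ P a →
    w a + sum (map w (filter P? xs)) ≤ sum (map w xs)
  sum-filter-∈ {a} {x ∷ xs} (here refl) ¬Pa with P? x
  ... | yes Pa = contradiction Pa ¬Pa
  ... | no  _  = +-monoʳ-≤ (w a) (sum-filter-≤ xs)
  sum-filter-∈ {a} {x ∷ xs} (there a∈xs) ¬Pa with P? x
  ... | no  _ = m≤n⇒m≤o+n (w x) (sum-filter-∈ a∈xs ¬Pa)
  ... | yes _ = begin
    w a + (w x + s) ≡⟨ +-exchange (w a) (w x) s ⟩
    w x + (w a + s) ≤⟨ +-monoʳ-≤ (w x) (sum-filter-∈ a∈xs ¬Pa) ⟩
    w x + sum (map w xs) ∎
    where
    open ≤-Reasoning
    s = sum (map w (filter P? xs))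

  -- The case of a merge, where two old equations leave together; `a ≢ b` keeps one entry from being
  -- counted twice.
  sum-filter-∈₂ : ∀ {a b xs} → a ∈ xs → b ∈ xs → a ≢ b → ¬ P a → ¬ P b →
    w a + w b + sum (map w (filter P? xs)) ≤ sum (map w xs)
  sum-filter-∈₂ (here refl) (here refl) a≢b _ _ = contradiction refl a≢b
  sum-filter-∈₂ {a} {b} {x ∷ xs} (here refl) (there b∈xs) _ ¬Pa ¬Pb with P? x
  ... | yes Pa = contradiction Pa ¬Pa
  ... | no  _  = begin
    w a + w b + s   ≡⟨ +-assoc (w a) (w b) s ⟩
    w a + (w b + s) ≤⟨ +-monoʳ-≤ (w a) (sum-filter-∈ b∈xs ¬Pb) ⟩
    w a + sum (map w xs) ∎
    where
    open ≤-Reasoning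
    s = sum (map w (filter P? xs))
  sum-filter-∈₂ {a} {b} {x ∷ xs} (there a∈xs) (here refl) _ ¬Pa ¬Pb with P? x
  ... | yes Pb = contradiction Pb ¬Pb
  ... | no  _  = begin
    w a + w b + s   ≡⟨ cong (_+ s) (+-comm (w a) (w b)) ⟩
    w b + w a + s   ≡⟨ +-assoc (w b) (w a) s ⟩
    w b + (w a + s) ≤⟨ +-monoʳ-≤ (w b) (sum-filter-∈ a∈xs ¬Pa) ⟩
    w b + sum (map w xs) ∎
    where
    open ≤-Reasoning
    s = sum (map w (filter P? xs))
  sum-filter-∈₂ {a} {b} {x ∷ xs} (there a∈xs) (there b∈xs) a≢b ¬Pa ¬Pb with P? x
  ... | no  _ = m≤n⇒m≤o+n (w x) (sum-filter-∈₂ a∈xs b∈xs a≢b ¬Pa ¬Pb)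
  ... | yes _ = begin
    w a + w b + (w x + s)   ≡⟨ +-exchange (w a + w b) (w x) s ⟩
    w x + (w a + w b + s)   ≤⟨ +-monoʳ-≤ (w x) (sum-filter-∈₂ a∈xs b∈xs a≢b ¬Pa ¬Pb) ⟩
    w x + sum (map w xs) ∎
    where
    open ≤-Reasoning
    s = sum (map w (filter P? xs))

≤-<⇒lex : ∀ {m n p q} → m ≤ n → p < q → ×-Lex _≡_ _<_ _<_ (m , p) (n , q)
≤-<⇒lex m≤n p<q with m≤n⇒m<n∨m≡n m≤n
... | inj₁ m<n = inj₁ m<n
... | inj₂ m≡n = inj₂ (m≡n , p<q)

module _ (S : Signature) where
  open Unification S
  open DecMembership _≟ᵛ_ using (_∈?_)

  _≟ᶜ_ : DecidableEquality Con
  _≟ᶜ_ = via-injection (↔⇒↣ con↔ℕ) _≟_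

  -- Equations that carry a head tree.

  boundCount : Maybe HeadTree → ℕ
  boundCount = maybe (const 1) 0

  heads : System → ℕ
  heads Ξ = sum (map (boundCount ∘ rhs) (equations Ξ))

  heads-▷ : ∀ Ξ E → heads (Ξ ▷ E) ≤ boundCount (rhs E) + heads Ξ
  heads-▷ Ξ E = +-monoʳ-≤ (boundCount (rhs E))
    (sum-filter-≤ (disjointFrom? E) (boundCount ∘ rhs) (equations Ξ))

  heads-▷-replace : ∀ Ξ {E F} → E ∈ equations Ξ → rep E ∈ lhs F →
    boundCount (rhs F) ≤ boundCount (rhs E) → heads (Ξ ▷ F) ≤ heads Ξ
  heads-▷-replace Ξ {E} {F} E∈Ξ rep∈F le = ≤-trans (+-monoˡ-≤ _ le)
    (sum-filter-∈ (disjointFrom? F) (boundCount ∘ rhs) E∈Ξ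
      -- The representing variable lies in both left-hand sides, so the filter removes `E`.
      (λ dis → dis (rep∈F , rep∈lhs E)))

  -- Phrased additively to avoid truncated subtraction: the weights of the two removed equations can
  -- be cancelled afterwards.
  heads-▷-merge : ∀ Ξ {E F r} → E ∈ equations Ξ → F ∈ equations Ξ → E ≢ F →
    boundCount (rhs E) + boundCount (rhs F) +
      heads (Ξ ▷ equation (lhs E ++ lhs F) (rep E) (∈-++⁺ˡ (rep∈lhs E)) r)
      ≤ boundCount r + heads Ξ
  heads-▷-merge Ξ {E} {F} {r} E∈Ξ F∈Ξ E≢F = begin
    bE + bF + (boundCount r + s) ≡⟨ +-exchange (bE + bF) (boundCount r) s ⟩
    boundCount r + (bE + bF + s) ≤⟨ +-monoʳ-≤ (boundCount r)
      (sum-filter-∈₂ (disjointFrom? G) (boundCount ∘ rhs) E∈Ξ F∈Ξ E≢F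
        (λ dis → dis (∈-++⁺ˡ (rep∈lhs E) , rep∈lhs E))
        (λ dis → dis (∈-++⁺ʳ (lhs E) (rep∈lhs F) , rep∈lhs F))) ⟩
    boundCount r + heads Ξ ∎
    where
    open ≤-Reasoning
    G  = equation (lhs E ++ lhs F) (rep E) (∈-++⁺ˡ (rep∈lhs E)) r
    bE = boundCount (rhs E)
    bF = boundCount (rhs F)
    s  = sum (map (boundCount ∘ rhs) (filter (disjointFrom? G) (equations Ξ)))

  boundCount-<∣> : ∀ r r′ → boundCount (r <∣> r′) ≤ boundCount r + boundCount r′
  boundCount-<∣> (just _) _ = s≤s z≤n
  boundCount-<∣> nothing  _ = ≤-refl

  heads-bind : ∀ {Ξ Ξ′ x h} → Bind Ξ x h Ξ′ → heads Ξ′ ≤ suc (heads Ξ)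
  heads-bind {Ξ} {x = x} {h} (absent _) =
    heads-▷ Ξ (equation (x ∷ []) x (here refl) (just h))
  heads-bind {Ξ} {h = h} (present {E} _ _) =
    heads-▷ Ξ (equation (lhs E) (rep E) (rep∈lhs E) (just h))

  heads-union : ∀ {Ξ Ξ′ x y} → Union Ξ x y Ξ′ nothing → heads Ξ′ ≤ heads Ξ
  heads-union same-var = ≤-refl
  heads-union {Ξ} (both-absent {x} {y} _ _ _) =
    heads-▷ Ξ (equation (x ∷ y ∷ []) x (here refl) nothing)
  heads-union {Ξ} (right-absent {y = y} {E} E∈Ξ _ _) =
    heads-▷-replace Ξ {F = equation (lhs E ++ y ∷ []) _ (∈-++⁺ˡ (rep∈lhs E)) (rhs E)} E∈Ξ (∈-++⁺ˡ (rep∈lhs E)) ≤-refl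
  heads-union (left-absent _ _ u) = heads-union u
  heads-union (same-equation _ _ _) = ≤-refl
  heads-union {Ξ} (merge {E = E} {F = F} E∈Ξ F∈Ξ E≢F _ _ _) =
    +-cancelˡ-≤ (boundCount (rhs E) + boundCount (rhs F)) _ _
      (≤-trans (heads-▷-merge Ξ {r = rhs E <∣> rhs F} E∈Ξ F∈Ξ E≢F)
               (+-monoˡ-≤ (heads Ξ) (boundCount-<∣> (rhs E) (rhs F))))

  heads-union-heads : ∀ {Ξ Ξ′ x y hs} → Union Ξ x y Ξ′ (just hs) → heads Ξ′ < heads Ξ
  heads-union-heads (left-absent _ _ u) = heads-union-heads u
  heads-union-heads {Ξ} (merge-heads {E = E} {F = F} {h₁ = h₁} E∈Ξ F∈Ξ E≢F _ _ rE rF) =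
    -- Two head trees leave and one enters: `2 + heads Ξ′ ≤ 1 + heads Ξ`.
    +-cancelˡ-≤ 1 _ _ (subst₂
      (λ r r′ → boundCount r + boundCount r′ + heads (Ξ ▷ G) ≤ suc (heads Ξ))
      rE rF (heads-▷-merge Ξ {r = just h₁} E∈Ξ F∈Ξ E≢F))
    where G = equation (lhs E ++ lhs F) (rep E) (∈-++⁺ˡ (rep∈lhs E)) (just h₁)

  -- Constructors left uncovered when two trees are superposed.

  mutual
    constructors : Tree → ℕ
    constructors (var _)    = 0
    constructors (con _ ts) = suc (constructors* ts)

    constructors* : ∀ {n} → Vec Tree n → ℕ
    constructors* []       = 0
    constructors* (t ∷ ts) = constructors t + constructors* ts

  -- The roots f and g are not compared: on a clash the value is irrelevant, and
  -- the surplus arguments of the longer vector are dropped.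
  mutual
    unmatched : Tree → Tree → ℕ
    unmatched (var _)    s          = constructors s
    unmatched (con f ts) (var _)    = constructors (con f ts)
    unmatched (con _ ts) (con _ ss) = unmatched* ts ss

    unmatched* : ∀ {m n} → Vec Tree m → Vec Tree n → ℕ
    unmatched* []       _        = 0
    unmatched* (_ ∷ _)  []       = 0
    unmatched* (t ∷ ts) (s ∷ ss) = unmatched t s + unmatched* ts ss

  -- The lengths may differ because the head tree of a bound variable can have another root than the
  -- tree it meets; hence only an inequality.
  unmatched*-vars : ∀ {m n} (xs : Vec Var m) (ts : Vec Tree n) →
    unmatched* (Vec.map var xs) ts ≤ constructors* ts
  unmatched*-vars []       _        = z≤n
  unmatched*-vars (_ ∷ _)  []       = z≤n
  unmatched*-vars (x ∷ xs) (t ∷ ts) = +-monoʳ-≤ (constructors t) (unmatched*-vars xs ts)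

  constructors*-vars : ∀ {n} (xs : Vec Var n) → constructors* (Vec.map var xs) ≡ 0
  constructors*-vars []       = refl
  constructors*-vars (_ ∷ xs) = constructors*-vars xs

  -- The roots cover each other and all arguments are variables, so the pair produced by a merge
  -- adds nothing to the potential.
  unmatched-heads : ∀ h₁ h₂ → unmatched ⌜ h₁ ⌝ ⌜ h₂ ⌝ ≡ 0
  unmatched-heads (head _ xs) (head _ ys) = n≤0⇒n≡0
    (≤-trans (unmatched*-vars xs (Vec.map var ys)) (≤-reflexive (constructors*-vars ys)))

  pairsUnmatched : List (Tree × Tree) → ℕ
  pairsUnmatched []             = 0
  pairsUnmatched ((t , s) ∷ ps) = unmatched t s + pairsUnmatched ps

  pairsUnmatched-zip : ∀ {n} (ts ss : Vec Tree n) →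
    pairsUnmatched (toList (Vec.zip ts ss)) ≡ unmatched* ts ss
  pairsUnmatched-zip []       []       = refl
  pairsUnmatched-zip (t ∷ ts) (s ∷ ss) = cong (unmatched t s +_) (pairsUnmatched-zip ts ss)

  -- The factor 2 makes binding a strict drop: one head tree is gained and one constructor is spent,
  -- which could balance under a factor 1.
  potential : Computation → ℕ
  potential (unify Ξ t s) = heads Ξ + 2 * unmatched t s
  potential (done Ξ)      = heads Ξ
  potential failed        = 0
  potential (c then ps)   = potential c + 2 * pairsUnmatched ps

  -- Plain size of the pending work.

  mutual
    -- A constructor weighs 2, more than a variable, so that `con-var` shrinks the size even at
    -- arity 0.
    treeSize : Tree → ℕ
    treeSize (var _)    = 1
    treeSize (con _ ts) = 2 + treesSize ts

    treesSize : ∀ {n} → Vec Tree n → ℕ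
    treesSize []       = 0
    treesSize (t ∷ ts) = suc (treeSize t + treesSize ts)

  -- The left tree counts twice so that moving a variable to the left is a decrease.
  pairSize : Tree → Tree → ℕ
  pairSize t s = 2 * treeSize t + treeSize s

  pairsSize : List (Tree × Tree) → ℕ
  pairsSize []             = 0
  pairsSize ((t , s) ∷ ps) = suc (pairSize t s + pairsSize ps)

  pairsSize-zip : ∀ {n} (ts ss : Vec Tree n) →
    pairsSize (toList (Vec.zip ts ss)) ≤ 2 * treesSize ts + treesSize ss
  pairsSize-zip []       []       = z≤n
  pairsSize-zip (t ∷ ts) (s ∷ ss) = begin
    suc (2 * treeSize t + treeSize s + pairsSize (toList (Vec.zip ts ss)))
      ≤⟨ s≤s (+-monoʳ-≤ (pairSize t s) (pairsSize-zip ts ss)) ⟩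
    suc (2 * treeSize t + treeSize s + (2 * treesSize ts + treesSize ss))
      -- A pair costs 1, while its left and right arguments bring 2 and 1.
      ≤⟨ m≤n+m _ 2 ⟩
    3 + (2 * treeSize t + treeSize s + (2 * treesSize ts + treesSize ss))
      ≡⟨ regroup (treeSize t) (treeSize s) (treesSize ts) (treesSize ss) ⟩
    2 * suc (treeSize t + treesSize ts) + suc (treeSize s + treesSize ss) ∎
    where
    open ≤-Reasoning
    regroup : ∀ a b c d → 3 + (2 * a + b + (2 * c + d)) ≡ 2 * suc (a + c) + suc (b + d)
    regroup = solve-∀

  -- Each pending pair and each frame has its own `suc`: `then-next` spends the former, `then-done`
  -- and `then-failed` the latter.
  computationSize : Computation → ℕ
  computationSize (unify _ t s) = pairSize t s
  computationSize (done _)      = 0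
  computationSize failed        = 0
  computationSize (c then ps)   = suc (computationSize c + pairsSize ps)

  measure : Config → ℕ × ℕ
  measure (_ ∣ c) = potential c , computationSize c

  infix 2 _≺_
  _≺_ : Config → Config → Set
  c ≺ d = ×-Lex _≡_ _<_ _<_ (measure c) (measure d)

  ≺-wellFounded : WellFounded _≺_
  ≺-wellFounded = On.wellFounded measure (×-wellFounded <-wellFounded <-wellFounded)

  -- Descent along every step.

  ⟶⇒≻ : ∀ {c d} → c ⟶ d → d ≺ c
  ⟶⇒≻ (var-var u) =
    ≤-<⇒lex (≤-trans (heads-union u) (m≤m+n _ _)) (s≤s z≤n)
  ⟶⇒≻ (var-var-heads {h₁ = h₁} {h₂} u)
    -- The size may grow here, as head trees replace variables; the lost head tree makes up for it.
    rewrite unmatched-heads h₁ h₂ = inj₁ (+-monoˡ-< 0 (heads-union-heads u))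
  ⟶⇒≻ (var-con-bound {Ξ = Ξ} {h = head _ xs} {ts = ts} _) =
    -- The root `f` is now laid on the root of the head tree and stops counting, even if the two
    -- differ.
    inj₁ (+-monoʳ-< (heads Ξ) (*-monoʳ-< 2 (s≤s (unmatched*-vars xs ts))))
  ⟶⇒≻ (var-con-free {Ξ = Ξ} {Ξ₀} {ts = ts} _ ys _ _ b) = inj₁ (begin-strict
    heads Ξ₀ + 2 * pairsUnmatched (toList (Vec.zip (Vec.map var ys) ts))
      ≡⟨ cong (λ k → heads Ξ₀ + 2 * k) (pairsUnmatched-zip (Vec.map var ys) ts) ⟩
    heads Ξ₀ + 2 * unmatched* (Vec.map var ys) ts
      -- The new head tree costs 1; the root `f`, no longer pending, accounts for the 2 below.
      ≤⟨ +-mono-≤ (heads-bind b) (*-monoʳ-≤ 2 (unmatched*-vars ys ts)) ⟩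
    suc (heads Ξ + 2 * constructors* ts)
      <⟨ n<1+n _ ⟩
    2 + (heads Ξ + 2 * constructors* ts)
      ≡⟨ regroup (heads Ξ) (constructors* ts) ⟩
    heads Ξ + 2 * suc (constructors* ts) ∎)
    where
    open ≤-Reasoning
    regroup : ∀ a b → 2 + (a + 2 * b) ≡ a + 2 * suc b
    regroup = solve-∀
  -- Both orders leave the same constructors uncovered, so the doubled left size has to decide.
  ⟶⇒≻ (con-var {ts = ts}) = inj₂ (refl , (begin-strict
    4 + treesSize ts          ≤⟨ +-monoʳ-≤ 4 (m≤m+n _ _) ⟩
    4 + 2 * treesSize ts      <⟨ n<1+n _ ⟩
    5 + 2 * treesSize ts      ≡⟨ regroup (treesSize ts) ⟩
    2 * (2 + treesSize ts) + 1 ∎))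
    where
    open ≤-Reasoning
    regroup : ∀ a → 5 + 2 * a ≡ 2 * (2 + a) + 1
    regroup = solve-∀
  ⟶⇒≻ (con-con {Ξ = Ξ} {ts = ts} {ss}) =
    inj₂ (cong (λ k → heads Ξ + 2 * k) (pairsUnmatched-zip ts ss) , (begin-strict
    1 + pairsSize (toList (Vec.zip ts ss))      ≤⟨ s≤s (pairsSize-zip ts ss) ⟩
    1 + (2 * treesSize ts + treesSize ss)       <⟨ m<n+m _ {5} (s≤s z≤n) ⟩
    6 + (2 * treesSize ts + treesSize ss)       ≡⟨ regroup (treesSize ts) (treesSize ss) ⟩
    2 * (2 + treesSize ts) + (2 + treesSize ss) ∎))
    where
    open ≤-Reasoning
    regroup : ∀ a b → 6 + (2 * a + b) ≡ 2 * (2 + a) + (2 + b)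
    regroup = solve-∀
  ⟶⇒≻ (con-clash _) = ≤-<⇒lex z≤n (s≤s z≤n)
  ⟶⇒≻ (then-step {ps = ps} st) with ⟶⇒≻ st
  -- Waiting pairs add equal amounts before and after the inner step.
  ... | inj₁ p<        = inj₁ (+-monoˡ-< (2 * pairsUnmatched ps) p<)
  ... | inj₂ (p≡ , s<) =
    inj₂ (cong (_+ 2 * pairsUnmatched ps) p≡ , s≤s (+-monoˡ-< (pairsSize ps) s<))
  ⟶⇒≻ (then-next {Ξ = Ξ} {t} {s} {ps}) =
    inj₂ (regroup (heads Ξ) (unmatched t s) (pairsUnmatched ps) , ≤-refl)
    where
    regroup : ∀ a b c → a + 2 * b + 2 * c ≡ a + 2 * (b + c)
    regroup = solve-∀
  ⟶⇒≻ then-done = ≤-<⇒lex (m≤m+n _ _) (s≤s z≤n)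
  ⟶⇒≻ then-failed = ≤-<⇒lex z≤n (s≤s z≤n)

  ⟶-wellFounded : WellFounded (flip _⟶_)
  ⟶-wellFounded = Subrelation.wellFounded ⟶⇒≻ ≺-wellFounded

  -- Progress: fresh variables and total operations.

  fresh : (L : List Var) → ∃[ x ] x ∉ L
  -- Under `var↔ℕ` the codes in `L` are bounded by their maximum; `b` is one above it.
  fresh L = from b , λ x∈L → <-irrefl refl (begin-strict
    b           ≡⟨ strictlyInverseˡ b ⟨
    to (from b) ≤⟨ All.lookup (Extrema.xs≤max 0 (map to L)) (∈-map⁺ to x∈L) ⟩
    Extrema.max 0 (map to L) <⟨ n<1+n _ ⟩
    b ∎)
    where
    open ≤-Reasoning
    open Inverse var↔ℕ
    b = suc (Extrema.max 0 (map to L))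

  freshVec : ∀ n (L : List Var) →
    ∃[ ys ] (Unique (toList {n = n} ys) × All (_∉ L) (toList ys))
  freshVec 0       L = [] , [] , []
  freshVec (suc n) L with fresh L
  -- Avoiding `y` as well makes the remaining variables distinct from it.
  ... | y , y∉L with freshVec n (y ∷ L)
  ... | ys , uniq , ys∉ =
    y ∷ ys
    , All.map (λ z∉ y≡z → z∉ (here (sym y≡z))) ys∉ ∷ uniq
    , y∉L ∷ All.map (_∘ there) ys∉

  ∈-dom⁻ : ∀ {Ξ x} → x ∈ dom Ξ → ∃[ E ] (E ∈ equations Ξ × x ∈ lhs E)
  ∈-dom⁻ {Ξ} x∈ = find (∈-concatMap⁻ lhs {xs = equations Ξ} x∈)

  -- The operations are relations; existence of some result suffices for progress, since descent is
  -- proved for every result.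
  find-total : ∀ Ξ x → ∃[ x′ ] ∃[ r ] Find Ξ x x′ r
  find-total Ξ x with x ∈? dom Ξ
  ... | no  x∉ = _ , _ , absent x∉
  ... | yes x∈ with ∈-dom⁻ {Ξ} x∈
  ... | _ , E∈Ξ , x∈E = _ , _ , present E∈Ξ x∈E

  bind-total : ∀ Ξ x h → ∃[ Ξ′ ] Bind Ξ x h Ξ′
  bind-total Ξ x h with x ∈? dom Ξ
  ... | no  x∉ = _ , absent x∉
  ... | yes x∈ with ∈-dom⁻ {Ξ} x∈
  ... | _ , E∈Ξ , x∈E = _ , present E∈Ξ x∈E

  merge-total : ∀ {Ξ x y E F} → E ∈ equations Ξ → F ∈ equations Ξ → E ≢ F →
    x ∈ lhs E → y ∈ lhs F → ∃[ Ξ′ ] ∃[ r ] Union Ξ x y Ξ′ r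
  merge-total {E = E} {F} E∈Ξ F∈Ξ E≢F x∈E y∈F with rhs E in rE | rhs F in rF
  ... | just _  | just _  = _ , _ , merge-heads E∈Ξ F∈Ξ E≢F x∈E y∈F rE rF
  ... | nothing | _       = _ , _ , merge E∈Ξ F∈Ξ E≢F x∈E y∈F (inj₁ rE)
  ... | just _  | nothing = _ , _ , merge E∈Ξ F∈Ξ E≢F x∈E y∈F (inj₂ rF)

  union-total : ∀ Ξ x y → ∃[ Ξ′ ] ∃[ r ] Union Ξ x y Ξ′ r
  union-total Ξ x y with x ≟ᵛ y
  ... | yes refl = _ , _ , same-var
  ... | no x≢y with x ∈? dom Ξ | y ∈? dom Ξ
  ... | no x∉  | no y∉ = _ , _ , both-absent x≢y x∉ y∉
  ... | no x∉  | yes y∈ with ∈-dom⁻ {Ξ} y∈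
  ...   | _ , F∈Ξ , y∈F = _ , _ , left-absent x∉ y∈ (right-absent F∈Ξ y∈F x∉)
  union-total Ξ x y | no x≢y | yes x∈ | no y∉ with ∈-dom⁻ {Ξ} x∈
  ...   | _ , E∈Ξ , x∈E = _ , _ , right-absent E∈Ξ x∈E y∉
  union-total Ξ x y | no x≢y | yes x∈ | yes y∈ with ∈-dom⁻ {Ξ} x∈ | ∈-dom⁻ {Ξ} y∈
  ...   | E , E∈Ξ , x∈E | F , F∈Ξ , y∈F with y ∈? lhs E
  ...     | yes y∈E = _ , _ , same-equation E∈Ξ x∈E y∈E
  -- Membership of `y` separates the two equations, so equality of equations never has to be
  -- decided.
  ...     | no  y∉E = merge-total E∈Ξ F∈Ξ (λ { refl → y∉E y∈F }) x∈E y∈F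

  progress : ∀ G c → Final (G ∣ c) ⊎ (∃[ d ] (G ∣ c ⟶ d))
  progress G (done _) = inj₁ done
  progress G failed   = inj₁ failed
  progress G (unify Ξ (var x) (var y)) with union-total Ξ x y
  ... | _ , nothing , u = inj₂ (_ , var-var u)
  ... | _ , just _  , u = inj₂ (_ , var-var-heads u)
  progress G (unify Ξ (var x) (con f ts)) with find-total Ξ x
  ... | _  , just _  , found = inj₂ (_ , var-con-bound found)
  ... | x′ , nothing , found
    with freshVec (arity f) (x ∷ treesVars ts ++ systemVars Ξ ++ G)
  ... | ys , uniq , ys∉ with bind-total Ξ x′ (head f ys)
  ... | _ , bound = inj₂ (_ , var-con-free found ys uniq ys∉ bound)
  progress G (unify Ξ (con _ _) (var _)) = inj₂ (_ , con-var)
  progress G (unify Ξ (con f _) (con g _)) with f ≟ᶜ g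
  ... | yes refl = inj₂ (_ , con-con)
  ... | no  f≢g  = inj₂ (_ , con-clash f≢g)
  progress G (c then ps) with progress G c
  ... | inj₂ ((_ ∣ _) , st) = inj₂ (_ , then-step st)
  ... | inj₁ failed = inj₂ (_ , then-failed)
  progress G (_ then [])    | inj₁ done = inj₂ (_ , then-done)
  progress G (_ then _ ∷ _) | inj₁ done = inj₂ (_ , then-next)

mainTheorem1 : (S : Signature) → let open Unification S in (Ξ : System) (t₁ t₂ : Tree) → Terminates (start Ξ t₁ t₂)
mainTheorem1 S Ξ t₁ t₂ = ⟶-wellFounded S _ , λ { {_ ∣ _} _ → progress S _ _ }
  where open Unification S
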